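{- Let $G$ be a finite simple graph with $d$ vertices, with chromatic polynomial $\chi_G(n)$, and let $h_G(z)$ be defined by $$\sum_{n=0}^{\infty} \chi_G(n) z^n = \frac{h_G(z)}{(1-z)^{d+1}}.$$ Then $h_G(z)$ is a polynomial of degree $d$ with nonnegative coefficients. Also, if $h_G(z) = \sum_{i=0}^{d} h_i z^i$, then for every integer $i$ with $1 \le i \le \left\lfloor \frac{d+1}{2} \right\rfloor$, $$h_{d} + h_{d-1} + \cdots + h_{d-i+1} - h_0 - h_1 - \cdots - h_{i-1} \ge 0.$$
   Context: The chromatic polynomial $\chi_G(n)$ counts the maps $\phi: V \to \{1, \ldots, n\}$ on the vertex set $V$ of $G$ such that $\phi(v) \ne \phi(w)$ whenever $vw$ is an edge of $G$. -}

module Defs where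

open import Level using (0ℓ)
open import Data.Nat.Base as ℕ using (ℕ; zero; suc; _∸_)
open import Data.Integer.Base using (ℤ; +_; 0ℤ; 1ℤ; -1ℤ; _*_)
open import Data.Integer.Properties using (+-0-commutativeMonoid)
open import Data.Fin.Base using (Fin; toℕ; finToFun)
open import Data.Fin.Properties using (_≟_; all?)
open import Data.Vec.Base using (tabulate; count)
open import Data.Product.Base using (_×_)
open import Relation.Nullary using (Dec; ¬?; _→-dec_)
open import Relation.Binary.Core using (Rel)
open import Relation.Binary.Definitions using (Decidable; Symmetric; Irreflexive)
open import Relation.Binary.PropositionalEquality.Core using (_≡_; _≢_)

open import Algebra.Properties.CommutativeMonoid.Sum +-0-commutativeMonoid public
  using (sum-syntax; sum⁺-syntax)

record SimpleGraph (d : ℕ) : Set₁ where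
  field
    Adj    : Rel (Fin d) 0ℓ
    adj?   : Decidable Adj
    sym    : Symmetric Adj
    irrefl : Irreflexive _≡_ Adj

module _ {d : ℕ} (G : SimpleGraph d) where
  open SimpleGraph G

  Proper : ∀ {n} → (Fin d → Fin n) → Set
  Proper φ = ∀ v w → Adj v w → φ v ≢ φ w

  proper? : ∀ {n} (φ : Fin d → Fin n) → Dec (Proper φ)
  proper? φ = all? λ v → all? λ w → adj? v w →-dec ¬? (φ v ≟ φ w)

  -- finToFun is a bijection from Fin (n ^ d) to the maps Fin d → Fin n (up to
  -- pointwise equality), so the vector lists every map exactly once.
  chromatic : ℕ → ℕ
  chromatic n = count proper? (tabulate {n = n ℕ.^ d} finToFun)

-- Formal power series over ℤ; a k is the coefficient of z^k.
PowerSeries : Set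
PowerSeries = ℕ → ℤ

infixl 7 _⊛_
infixr 8 _^ˢ_

_⊛_ : PowerSeries → PowerSeries → PowerSeries
(a ⊛ b) n = ∑[ k ≤ n ] (a (toℕ k) * b (n ∸ toℕ k))

1ˢ : PowerSeries
1ˢ zero    = 1ℤ
1ˢ (suc _) = 0ℤ

_^ˢ_ : PowerSeries → ℕ → PowerSeries
a ^ˢ zero  = 1ˢ
a ^ˢ suc m = a ⊛ (a ^ˢ m)

1-z : PowerSeries
1-z zero          = 1ℤ
1-z (suc zero)    = -1ℤ
1-z (suc (suc _)) = 0ℤ

chromaticSeries : ∀ {d} → SimpleGraph d → PowerSeries
chromaticSeries G n = + chromatic G n

-- The h with  Σₙ χ_G(n) zⁿ = h(z) / (1 - z)^(d+1),  denominator cleared.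
-- A priori it is only a power series.
h-series : ∀ {d} → SimpleGraph d → PowerSeries
h-series {d} G = 1-z ^ˢ suc d ⊛ chromaticSeries G

IsPolynomialOfDegree : PowerSeries → ℕ → Set
IsPolynomialOfDegree a m = a m ≢ 0ℤ × (∀ k → m ℕ.< k → a k ≡ 0ℤ)

{-# OPTIONS --safe #-}

-- Multiplication by 1 - z is the difference operator Δ, so h = Δ^(d+1) χ.
--
-- Nonnegativity.  Flag every vertex and let Z_L(c) count the proper colourings
-- by 0, …, c in which only flagged vertices may receive c.  Lowering the flag
-- of v removes the colourings with v coloured c, and these are counted by Z on
-- one vertex fewer, with the flags of the neighbours of v lowered.  By induction
-- Δ^k Z_L (k vertices) therefore increases with the set of flags.  All flags
-- lowered gives χ(c) and all flags raised gives χ(c+1), so that Δ^k Z_L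
-- dominates its own shift, that is, Δ^(k+1) Z_L ≥ 0.
--
-- The inequality.  Let s_i be the left-hand side.  Deletion-contraction reads
-- h = h' - (1 - z) g, where h' and g belong to the graph with an edge deleted
-- and contracted, and it telescopes to s_i = s'_i + g_(d-i) + g_(i-1), whose
-- last two terms are nonnegative.  Adding an isolated vertex multiplies χ by n
-- and gives a similar positive recursion for s_i.
module Submission where

open import Level using (0ℓ)
open import Data.Bool.Base using (Bool; true; false; if_then_else_; not; _∧_)
open import Data.Bool.Properties using (∧-identityʳ)
open import Data.Nat.Base as ℕ using (ℕ; zero; suc; _∸_; ⌊_/2⌋; z≤n; s≤s)
import Data.Nat.Properties as ℕ
open import Data.Integer.Base using (ℤ; +_; 0ℤ; 1ℤ; -1ℤ; _+_; _*_; _-_; _≤_; _<_; +≤+; +<+)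
open import Data.Integer.Properties as ℤ using (+-0-commutativeMonoid)
open import Data.Integer.Tactic.RingSolver using (solve-∀)
open import Data.Fin.Base using (Fin; zero; suc; toℕ; finToFun; combine; _↑ˡ_; _↑ʳ_)
open import Data.Fin.Properties as Fin using (all?; any?; remQuot-combine; toℕ-injective)
open import Data.List.Base as List
  using (List; []; _∷_; _++_; _∷ʳ_; map; filter; downFrom; length; allFin)
open import Data.List.Properties
  using (filter-all; filter-reject; length-map; length-++-sucʳ; length-tabulate; ∷ʳ-++)
open import Data.List.Membership.Propositional using (_∈_)
open import Data.List.Membership.Propositional.Properties using (∈-filter⁺; ∈-filter⁻; ∈-allFin)
import Data.List.Membership.DecPropositional as DecMembership
open import Data.List.Relation.Unary.All as All using (All; []; _∷_)
open import Data.Product.Base using (_×_; _,_; proj₁; proj₂)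
open import Data.Sum.Base using (_⊎_; inj₁; inj₂)
open import Data.Vec.Base using (Vec; []; _∷_; lookup; tabulate; count)
open import Data.Vec.Properties using (lookup∘tabulate; tabulate-cong)
open import Function.Base using (_∘_; _$_)
open import Function.Bundles using (_⇔_; mk⇔)
open import Relation.Nullary using (Dec; yes; no; ¬_; ¬?; does; _→-dec_; _×-dec_; _⊎-dec_)
open import Relation.Nullary.Decidable using (does-⇔; dec-true; dec-false)
open import Relation.Unary using (Pred; Decidable)
open import Relation.Binary.Core using (Rel)
import Relation.Binary.Definitions as Binary
open import Relation.Binary.PropositionalEquality
open import Algebra.Properties.CommutativeMonoid.Sum +-0-commutativeMonoid
  using (sum-cong-≗; ∑-distrib-+; sum-replicate-zero)
open import Defs

open ≡-Reasoning

-- The difference operator on power series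

shift : PowerSeries → PowerSeries
shift a zero    = 0ℤ
shift a (suc n) = a n

Δ : PowerSeries → PowerSeries
Δ a n = a n - shift a n

Δ^ : ℕ → PowerSeries → PowerSeries
Δ^ zero    a = a
Δ^ (suc m) a = Δ (Δ^ m a)

shift-cong : ∀ {a b} → a ≗ b → shift a ≗ shift b
shift-cong e zero    = refl
shift-cong e (suc n) = e n

Δ-cong : ∀ {a b} → a ≗ b → Δ a ≗ Δ b
Δ-cong e n = cong₂ _-_ (e n) (shift-cong e n)

Δ^-cong : ∀ m {a b} → a ≗ b → Δ^ m a ≗ Δ^ m b
Δ^-cong zero    e = e
Δ^-cong (suc m) e = Δ-cong (Δ^-cong m e)

Δ-minus : ∀ a b → Δ (λ n → a n - b n) ≗ λ n → Δ a n - Δ b n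
Δ-minus a b zero    = lemma (a 0) (b 0)
  where
  lemma : ∀ x y → x - y - 0ℤ ≡ x - 0ℤ - (y - 0ℤ)
  lemma = solve-∀
Δ-minus a b (suc n) = lemma (a (suc n)) (b (suc n)) (a n) (b n)
  where
  lemma : ∀ x y u v → x - y - (u - v) ≡ x - u - (y - v)
  lemma = solve-∀

Δ^-minus : ∀ m a b → Δ^ m (λ n → a n - b n) ≗ λ n → Δ^ m a n - Δ^ m b n
Δ^-minus zero    a b n = refl
Δ^-minus (suc m) a b n =
  trans (Δ-cong (Δ^-minus m a b) n) (Δ-minus (Δ^ m a) (Δ^ m b) n)

Δ-shift : ∀ a → Δ (shift a) ≗ shift (Δ a)
Δ-shift a zero    = refl
Δ-shift a (suc n) = refl

Δ^-shift : ∀ m a → Δ^ m (shift a) ≗ shift (Δ^ m a)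
Δ^-shift zero    a n = refl
Δ^-shift (suc m) a n =
  trans (Δ-cong (Δ^-shift m a) n) (Δ-shift (Δ^ m a) n)

Δ^-zero : ∀ m {a} → (∀ n → a n ≡ 0ℤ) → ∀ n → Δ^ m a n ≡ 0ℤ
Δ^-zero zero    e n       = e n
Δ^-zero (suc m) e zero    = cong (_- 0ℤ) (Δ^-zero m e 0)
Δ^-zero (suc m) e (suc n) = cong₂ _-_ (Δ^-zero m e (suc n)) (Δ^-zero m e n)

-- The operator `z d/dz`. Adding an isolated vertex to a graph applies it to the chromatic series.
θ : PowerSeries → PowerSeries
θ a n = + n * a n

Δ-θ : ∀ a n → Δ (θ a) n ≡ θ (Δ a) n + shift a n
Δ-θ a zero    = refl
Δ-θ a (suc n) = lemma (+ n) (a (suc n)) (a n)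
  where
  lemma : ∀ k x y → (1ℤ + k) * x - k * y ≡ (1ℤ + k) * (x - y) + y
  lemma = solve-∀

-- The product rule for `z d/dz` on `(1-z)^(m+1) a`, rearranged: differentiating the power of `1-z`
-- produces the second summand.
Δ^-θ : ∀ m a n →
  Δ^ (suc m) (θ a) n ≡ θ (Δ^ (suc m) a) n + + suc m * shift (Δ^ m a) n
Δ^-θ zero    a n = trans (Δ-θ a n) (cong (_+_ (θ (Δ a) n)) (sym (ℤ.*-identityˡ _)))
Δ^-θ (suc m) a n = begin
  Δ (Δ^ (suc m) (θ a)) n
    ≡⟨ Δ-cong (Δ^-θ m a) n ⟩
  Δ (λ i → θ b i + + suc m * shift c i) n
    ≡⟨ split n ⟩
  Δ (θ b) n + + suc m * shift b n
    ≡⟨ cong (_+ + suc m * shift b n) (Δ-θ b n) ⟩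
  θ (Δ b) n + shift b n + + suc m * shift b n
    ≡⟨ lemma (θ (Δ b) n) (shift b n) (+ suc m) ⟩
  θ (Δ b) n + (1ℤ + + suc m) * shift b n ∎
  where
  c = Δ^ m a
  b = Δ c
  lemma : ∀ x y k → x + y + k * y ≡ x + (1ℤ + k) * y
  lemma = solve-∀
  lemma₀ : ∀ x k → x + k * 0ℤ - 0ℤ ≡ x - 0ℤ + k * 0ℤ
  lemma₀ = solve-∀
  lemma₁ : ∀ x y k u v → x + k * u - (y + k * v) ≡ x - y + k * (u - v)
  lemma₁ = solve-∀
  split : ∀ n → Δ (λ i → θ b i + + suc m * shift c i) n ≡ Δ (θ b) n + + suc m * shift b n
  split zero    = lemma₀ (θ b 0) (+ suc m)
  split (suc n) = lemma₁ (θ b (suc n)) (θ b n) (+ suc m) (c n) (shift c n)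

1-z-⊛ : ∀ b → (1-z ⊛ b) ≗ Δ b
1-z-⊛ b zero    = lemma (b 0)
  where
  lemma : ∀ x → 1ℤ * x + 0ℤ ≡ x - 0ℤ
  lemma = solve-∀
1-z-⊛ b (suc n) = begin
  1ℤ * b (suc n) + (-1ℤ * b n + ∑[ k < n ] (0ℤ * b (n ∸ suc (toℕ k))))
    ≡⟨ cong (λ s → 1ℤ * b (suc n) + (-1ℤ * b n + s)) (sum-replicate-zero n) ⟩
  1ℤ * b (suc n) + (-1ℤ * b n + 0ℤ)
    ≡⟨ lemma (b (suc n)) (b n) ⟩
  b (suc n) - b n ∎
  where
  lemma : ∀ x y → 1ℤ * x + (-1ℤ * y + 0ℤ) ≡ x - y
  lemma = solve-∀

1ˢ-⊛ : ∀ a → (1ˢ ⊛ a) ≗ a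
1ˢ-⊛ a n = begin
  1ℤ * a n + ∑[ k < n ] (0ℤ * a (n ∸ suc (toℕ k)))
    ≡⟨ cong₂ _+_ (ℤ.*-identityˡ (a n)) (sum-replicate-zero n) ⟩
  a n + 0ℤ
    ≡⟨ ℤ.+-identityʳ (a n) ⟩
  a n ∎

⊛-congˡ : ∀ {a b} c → a ≗ b → (a ⊛ c) ≗ (b ⊛ c)
⊛-congˡ c e n = sum-cong-≗ {suc n} (λ k → cong (_* c (n ∸ toℕ k)) (e (toℕ k)))

-- Associativity of the convolution for the factor `1-z`, which suffices to unfold a power of `1-z`.
-- The subtracted half of `Δ b`, convolved with `a`, is the preceding coefficient of `b ⊛ a`.
Δ-⊛ : ∀ b a → (Δ b ⊛ a) ≗ Δ (b ⊛ a)
Δ-⊛ b a zero    = lemma (b 0) (a 0)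
  where
  lemma : ∀ x y → (x - 0ℤ) * y + 0ℤ ≡ x * y + 0ℤ - 0ℤ
  lemma = solve-∀
Δ-⊛ b a (suc n) = begin
  (b 0 - 0ℤ) * a (suc n) + ∑[ k < suc n ] (Δ b (suc (toℕ k)) * a (n ∸ toℕ k))
    ≡⟨ cong (_+_ ((b 0 - 0ℤ) * a (suc n)))
         (trans (lemma₂ _ ((b ⊛ a) n)) (cong (_- (b ⊛ a) n) rearranged)) ⟩
  (b 0 - 0ℤ) * a (suc n)
    + (∑[ k < suc n ] (b (suc (toℕ k)) * a (n ∸ toℕ k)) - (b ⊛ a) n)
    ≡⟨ lemma (b 0) (a (suc n)) (∑[ k < suc n ] (b (suc (toℕ k)) * a (n ∸ toℕ k))) ((b ⊛ a) n) ⟩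
  (b ⊛ a) (suc n) - (b ⊛ a) n ∎
  where
  lemma : ∀ x y s t → (x - 0ℤ) * y + (s - t) ≡ x * y + s - t
  lemma = solve-∀
  lemma₁ : ∀ x y z → (x - y) * z + y * z ≡ x * z
  lemma₁ = solve-∀
  lemma₂ : ∀ s t → s ≡ s + t - t
  lemma₂ = solve-∀
  rearranged :
    ∑[ k < suc n ] (Δ b (suc (toℕ k)) * a (n ∸ toℕ k)) + (b ⊛ a) n
    ≡ ∑[ k < suc n ] (b (suc (toℕ k)) * a (n ∸ toℕ k))
  rearranged = begin
    ∑[ k < suc n ] (Δ b (suc (toℕ k)) * a (n ∸ toℕ k)) + (b ⊛ a) n
      ≡⟨ ∑-distrib-+ {suc n} (λ k → Δ b (suc (toℕ k)) * a (n ∸ toℕ k))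
           (λ k → b (toℕ k) * a (n ∸ toℕ k)) ⟨
    ∑[ k < suc n ] (Δ b (suc (toℕ k)) * a (n ∸ toℕ k) + b (toℕ k) * a (n ∸ toℕ k))
      ≡⟨ sum-cong-≗ {suc n} (λ k → lemma₁ (b (suc (toℕ k))) (b (toℕ k)) (a (n ∸ toℕ k))) ⟩
    ∑[ k < suc n ] (b (suc (toℕ k)) * a (n ∸ toℕ k)) ∎

1-z^-⊛ : ∀ m a → (1-z ^ˢ m ⊛ a) ≗ Δ^ m a
1-z^-⊛ zero    a n = 1ˢ-⊛ a n
1-z^-⊛ (suc m) a n = begin
  ((1-z ⊛ (1-z ^ˢ m)) ⊛ a) n ≡⟨ ⊛-congˡ a (1-z-⊛ (1-z ^ˢ m)) n ⟩
  (Δ (1-z ^ˢ m) ⊛ a) n       ≡⟨ Δ-⊛ (1-z ^ˢ m) a n ⟩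
  Δ (1-z ^ˢ m ⊛ a) n         ≡⟨ Δ-cong (1-z^-⊛ m a) n ⟩
  Δ (Δ^ m a) n               ∎

∑-last : ∀ (f : ℕ → ℤ) n → ∑[ j < suc n ] f (toℕ j) ≡ ∑[ j < n ] f (toℕ j) + f n
∑-last f zero    = ℤ.+-comm (f 0) 0ℤ
∑-last f (suc n) = trans (cong (_+_ (f 0)) (∑-last (f ∘ suc) n)) (sym (ℤ.+-assoc (f 0) _ _))

-- The gaps `s_i` between top and bottom partial sums

gap : PowerSeries → ℕ → ℕ → ℤ
gap h d i = (∑[ j < i ] h (d ∸ toℕ j)) - (∑[ j < i ] h (toℕ j))

gap-suc : ∀ h d i → gap h d (suc i) ≡ gap h d i + (h (d ∸ i) - h i)
gap-suc h d i = begin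
  gap h d (suc i)
    ≡⟨ cong₂ _-_ (∑-last (λ j → h (d ∸ j)) i) (∑-last h i) ⟩
  (∑[ j < i ] h (d ∸ toℕ j)) + h (d ∸ i) - (∑[ j < i ] h (toℕ j) + h i)
    ≡⟨ lemma (∑[ j < i ] h (d ∸ toℕ j)) (h (d ∸ i)) (∑[ j < i ] h (toℕ j)) (h i) ⟩
  gap h d i + (h (d ∸ i) - h i) ∎
  where
  lemma : ∀ s x t y → s + x - (t + y) ≡ s - t + (x - y)
  lemma = solve-∀

gap-cong : ∀ {h g} d i → h ≗ g → gap h d i ≡ gap g d i
gap-cong d i e = cong₂ _-_ (sum-cong-≗ {i} (λ j → e (d ∸ toℕ j))) (sum-cong-≗ {i} (λ j → e (toℕ j)))

-- For `i = d+1` both sums run over all the coefficients, in opposite orders.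
gap-total : ∀ h d → gap h d (suc d) ≡ 0ℤ
gap-total h d = begin
  gap h d (suc d)
    ≡⟨ cong (_- ∑[ j < suc d ] h (toℕ j)) (trans
         (sym (ℤ.+-identityʳ (∑[ j < suc d ] h (d ∸ toℕ j))))
         (total (suc d) 0 (ℕ.+-identityʳ (suc d)))) ⟩
  ∑[ j < suc d ] h (toℕ j) - ∑[ j < suc d ] h (toℕ j)
    ≡⟨ ℤ.+-inverseʳ (∑[ j < suc d ] h (toℕ j)) ⟩
  0ℤ ∎
  where
  -- When `i + m = d+1`, the top `i` and the bottom `m` coefficients partition all of them. The
  -- induction moves the last term of the first sum to the end of the second.
  total : ∀ i m → i ℕ.+ m ≡ suc d →
    ∑[ j < i ] h (d ∸ toℕ j) + ∑[ j < m ] h (toℕ j) ≡ ∑[ j < suc d ] h (toℕ j)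
  total zero    m refl = ℤ.+-identityˡ _
  total (suc i) m e    = begin
    ∑[ j < suc i ] h (d ∸ toℕ j) + ∑[ j < m ] h (toℕ j)
      ≡⟨ cong (_+ ∑[ j < m ] h (toℕ j)) (∑-last (λ j → h (d ∸ j)) i) ⟩
    ∑[ j < i ] h (d ∸ toℕ j) + h (d ∸ i) + ∑[ j < m ] h (toℕ j)
      ≡⟨ cong (λ k → ∑[ j < i ] h (d ∸ toℕ j) + h k + ∑[ j < m ] h (toℕ j)) d∸i≡m ⟩
    ∑[ j < i ] h (d ∸ toℕ j) + h m + ∑[ j < m ] h (toℕ j)
      ≡⟨ lemma (∑[ j < i ] h (d ∸ toℕ j)) (h m) (∑[ j < m ] h (toℕ j)) ⟩
    ∑[ j < i ] h (d ∸ toℕ j) + (∑[ j < m ] h (toℕ j) + h m)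
      ≡⟨ cong (_+_ (∑[ j < i ] h (d ∸ toℕ j))) (∑-last h m) ⟨
    ∑[ j < i ] h (d ∸ toℕ j) + ∑[ j < suc m ] h (toℕ j)
      ≡⟨ total i (suc m) (trans (ℕ.+-suc i m) e) ⟩
    ∑[ j < suc d ] h (toℕ j) ∎
    where
    lemma : ∀ x y z → x + y + z ≡ x + (z + y)
    lemma = solve-∀
    d∸i≡m : d ∸ i ≡ m
    d∸i≡m = trans (cong (_∸ i) (sym (ℕ.suc-injective e))) (ℕ.m+n∸m≡n i m)

-- Nonnegativity via list colourings

∑∈ : {A : Set} → List A → (A → ℤ) → ℤ
∑∈ []      f = 0ℤ
∑∈ (x ∷ S) f = f x + ∑∈ S f

module _ {A : Set} where

  ∑∈-cong : ∀ (S : List A) {f g : A → ℤ} → f ≗ g → ∑∈ S f ≡ ∑∈ S g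
  ∑∈-cong []      e = refl
  ∑∈-cong (x ∷ S) e = cong₂ _+_ (e x) (∑∈-cong S e)

  ∑∈-zero : ∀ (S : List A) → ∑∈ S (λ _ → 0ℤ) ≡ 0ℤ
  ∑∈-zero []      = refl
  ∑∈-zero (x ∷ S) = trans (ℤ.+-identityˡ _) (∑∈-zero S)

  ∑∈-+ : ∀ (S : List A) (f g : A → ℤ) → ∑∈ S (λ x → f x + g x) ≡ ∑∈ S f + ∑∈ S g
  ∑∈-+ []      f g = refl
  ∑∈-+ (x ∷ S) f g = trans (cong (_+_ (f x + g x)) (∑∈-+ S f g)) (lemma (f x) (g x) (∑∈ S f) (∑∈ S g))
    where
    lemma : ∀ a b c d → a + b + (c + d) ≡ a + c + (b + d)
    lemma = solve-∀

  ∑∈-filter : ∀ {P : Pred A 0ℓ} (P? : Decidable P) (S : List A) (f : A → ℤ) →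
    ∑∈ (filter P? S) f ≡ ∑∈ S (λ x → if does (P? x) then f x else 0ℤ)
  ∑∈-filter P? []      f = refl
  ∑∈-filter P? (x ∷ S) f with does (P? x)
  ... | true  = cong (_+_ (f x)) (∑∈-filter P? S f)
  ... | false = trans (∑∈-filter P? S f) (sym (ℤ.+-identityˡ _))

∑∈-comm : ∀ {A B : Set} (S : List A) (T : List B) (f : A → B → ℤ) →
  ∑∈ S (λ x → ∑∈ T (λ y → f x y)) ≡ ∑∈ T (λ y → ∑∈ S (λ x → f x y))
∑∈-comm []      T f = sym (∑∈-zero T)
∑∈-comm (x ∷ S) T f = trans (cong (_+_ (∑∈ T (f x))) (∑∈-comm S T f))
                            (sym (∑∈-+ T (f x) (λ y → ∑∈ S (λ z → f z y))))

filter-comm : ∀ {A : Set} {P Q : Pred A 0ℓ} (P? : Decidable P) (Q? : Decidable Q) (S : List A) →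
  filter P? (filter Q? S) ≡ filter Q? (filter P? S)
filter-comm P? Q? [] = refl
filter-comm P? Q? (x ∷ S) with does (P? x) in p | does (Q? x) in q
... | true  | true  rewrite p | q = cong (x ∷_) (filter-comm P? Q? S)
... | true  | false rewrite q     = filter-comm P? Q? S
... | false | true  rewrite p     = filter-comm P? Q? S
... | false | false               = filter-comm P? Q? S

differs? : ∀ c → Decidable (λ x → ¬ (c ≡ x))
differs? c x = ¬? (c ℕ.≟ x)

remove : ℕ → List ℕ → List ℕ
remove c = filter (differs? c)

remove-downFrom : ∀ {c n} → n ℕ.≤ c → remove c (downFrom n) ≡ downFrom n
remove-downFrom {c} n≤c = filter-all (differs? c) (above n≤c)
  where
  above : ∀ {n} → n ℕ.≤ c → All (λ x → ¬ (c ≡ x)) (downFrom n)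
  above {zero}  _   = []
  above {suc n} n<c = (λ { refl → ℕ.<-irrefl refl n<c }) ∷ above (ℕ.<⇒≤ n<c)

module ListColouring {X : Set} (adj : X → X → Bool) where

  forbid : X → ℕ → (X → List ℕ) → (X → List ℕ)
  forbid x c g y = if adj x y then remove c (g y) else g y

  -- Counts list colourings by colouring the vertices of `L` in order. Each choice is struck from
  -- the lists of its neighbours, so properness never has to be tested.
  colourings : List X → (X → List ℕ) → ℤ
  colourings []      g = 1ℤ
  colourings (x ∷ L) g = ∑∈ (g x) (λ c → colourings L (forbid x c g))

  forbid-cong : ∀ x c {g g′} → g ≗ g′ → forbid x c g ≗ forbid x c g′
  forbid-cong x c e y = cong (λ S → if adj x y then remove c S else S) (e y)

  colourings-cong : ∀ L {g g′} → g ≗ g′ → colourings L g ≡ colourings L g′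
  colourings-cong []      e = refl
  colourings-cong (x ∷ L) {g} {g′} e = trans
    (cong (λ S → ∑∈ S (λ c → colourings L (forbid x c g))) (e x))
    (∑∈-cong (g′ x) (λ c → colourings-cong L (forbid-cong x c e)))

  -- Converts a change of flags along the vertex list into a change of the colour lists.
  colourings-map : ∀ (f : X → X) → (∀ x y → adj (f x) (f y) ≡ adj x y) →
    ∀ L g → colourings (map f L) g ≡ colourings L (g ∘ f)
  colourings-map f f-adj []      g = refl
  colourings-map f f-adj (x ∷ L) g = ∑∈-cong (g (f x)) λ c → trans
    (colourings-map f f-adj L (forbid (f x) c g))
    (colourings-cong L λ y → cong (λ b → if b then remove c (g (f y)) else g (f y)) (f-adj x y))

  module _ (adj-sym : ∀ x y → adj x y ≡ adj y x) where

    forbid-comm : ∀ x c y d g → forbid x c (forbid y d g) ≗ forbid y d (forbid x c g)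
    forbid-comm x c y d g z with adj x z | adj y z
    ... | true  | true  = filter-comm (differs? c) (differs? d) (g z)
    ... | true  | false = refl
    ... | false | true  = refl
    ... | false | false = refl

    -- Both sides sum over the same pairs of colours for `x` and `y`: all pairs if the vertices are
    -- not adjacent, the unequal pairs if they are.
    forbid-exchange : ∀ x y g (H : ℕ → ℕ → ℤ) →
      ∑∈ (g y) (λ d → ∑∈ (forbid y d g x) (λ c → H c d))
      ≡ ∑∈ (g x) (λ c → ∑∈ (forbid x c g y) (λ d → H c d))
    forbid-exchange x y g H rewrite adj-sym y x with adj x y
    ... | false = ∑∈-comm (g y) (g x) (λ d c → H c d)
    ... | true  = begin
      ∑∈ (g y) (λ d → ∑∈ (remove d (g x)) (λ c → H c d))
        ≡⟨ ∑∈-cong (g y) (λ d → ∑∈-filter (differs? d) (g x) (λ c → H c d)) ⟩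
      ∑∈ (g y) (λ d → ∑∈ (g x) (λ c → if does (differs? d c) then H c d else 0ℤ))
        ≡⟨ ∑∈-comm (g y) (g x) _ ⟩
      ∑∈ (g x) (λ c → ∑∈ (g y) (λ d → if does (differs? d c) then H c d else 0ℤ))
        ≡⟨ ∑∈-cong (g x) (λ c → ∑∈-cong (g y) (λ d →
             cong (λ b → if b then H c d else 0ℤ)
               (does-⇔ (mk⇔ (_∘ sym) (_∘ sym)) (differs? d c) (differs? c d)))) ⟩
      ∑∈ (g x) (λ c → ∑∈ (g y) (λ d → if does (differs? c d) then H c d else 0ℤ))
        ≡⟨ ∑∈-cong (g x) (λ c → ∑∈-filter (differs? c) (g y) (H c)) ⟨
      ∑∈ (g x) (λ c → ∑∈ (remove c (g y)) (λ d → H c d)) ∎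

    -- The count does not depend on the order of the vertices: `x` is moved to the front past one
    -- entry of `P` at a time.
    colour-first : ∀ P x Q g →
      colourings (P ++ x ∷ Q) g ≡ ∑∈ (g x) (λ c → colourings (P ++ Q) (forbid x c g))
    colour-first []      x Q g = refl
    colour-first (y ∷ P) x Q g = begin
      ∑∈ (g y) (λ d → colourings (P ++ x ∷ Q) (forbid y d g))
        ≡⟨ ∑∈-cong (g y) (λ d → colour-first P x Q (forbid y d g)) ⟩
      ∑∈ (g y) (λ d → ∑∈ (forbid y d g x) (λ c → colourings (P ++ Q) (forbid x c (forbid y d g))))
        ≡⟨ forbid-exchange x y g (λ c d → colourings (P ++ Q) (forbid x c (forbid y d g))) ⟩
      ∑∈ (g x) (λ c → ∑∈ (forbid x c g y) (λ d → colourings (P ++ Q) (forbid x c (forbid y d g))))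
        ≡⟨ ∑∈-cong (g x) (λ c → ∑∈-cong (forbid x c g y) (λ d →
             colourings-cong (P ++ Q) (forbid-comm x c y d g))) ⟩
      ∑∈ (g x) (λ c → ∑∈ (forbid x c g y) (λ d → colourings (P ++ Q) (forbid y d (forbid x c g)))) ∎

module Nonnegativity {V : Set} (A : V → V → Bool) (A-sym : ∀ u v → A u v ≡ A v u) where

  adj : V × Bool → V × Bool → Bool
  adj (u , _) (v , _) = A u v

  adj-sym : ∀ x y → adj x y ≡ adj y x
  adj-sym (u , _) (v , _) = A-sym u v

  open ListColouring adj

  palette : ℕ → V × Bool → List ℕ
  palette c (_ , t) = downFrom (if t then suc c else c)

  Z : List (V × Bool) → PowerSeries
  Z L c = colourings L (palette c)

  lower lift : V × Bool → V × Bool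
  lower (v , _) = v , false
  lift  (v , _) = v , true

  lowerNeighbours : V → V × Bool → V × Bool
  lowerNeighbours m (v , t) = v , t ∧ not (A m v)

  -- Among the neighbours of `m`, only the flagged ones have `c` in their palette, and there it is
  -- the first entry, so striking it amounts to lowering the flag. This keeps the remaining problem
  -- inside the family `Z`.
  forbid-palette : ∀ m t c → forbid (m , t) c (palette c) ≗ palette c ∘ lowerNeighbours m
  forbid-palette m t c (v , s) with A m v
  forbid-palette m t c (v , s)     | false rewrite ∧-identityʳ s = refl
  forbid-palette m t c (v , false) | true  = remove-downFrom ℕ.≤-refl
  forbid-palette m t c (v , true)  | true  = trans
    (filter-reject (differs? c) (λ c≢c → c≢c refl)) (remove-downFrom ℕ.≤-refl)

  -- Split by whether `m` receives `c`: the flagged palette of `m` is `c` followed by its unflagged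
  -- palette.
  Z-flip : ∀ P m Q c →
    Z (P ++ (m , true) ∷ Q) c ≡ Z (map (lowerNeighbours m) (P ++ Q)) c + Z (P ++ (m , false) ∷ Q) c
  Z-flip P m Q c = begin
    colourings (P ++ (m , true) ∷ Q) (palette c)
      ≡⟨ colour-first adj-sym P (m , true) Q (palette c) ⟩
    colourings (P ++ Q) (forbid (m , true) c (palette c)) + rest
      -- `adj` ignores flags, so forbidding at `(m , true)` and at `(m , false)` is definitionally
      -- the same and `rest` is the count for the lowered flag.
      ≡⟨ cong₂ _+_ coloured-c (sym (colour-first adj-sym P (m , false) Q (palette c))) ⟩
    Z (map (lowerNeighbours m) (P ++ Q)) c + Z (P ++ (m , false) ∷ Q) c ∎
    where
    rest = ∑∈ (downFrom c) (λ d → colourings (P ++ Q) (forbid (m , true) d (palette c)))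
    coloured-c = trans
      (colourings-cong (P ++ Q) (forbid-palette m true c))
      (sym (colourings-map (lowerNeighbours m) (λ _ _ → refl) (P ++ Q) (palette c)))

  -- On both sides every vertex has the palette 0, ..., `c`.
  Z-lower-suc : ∀ L c → Z (map lower L) (suc c) ≡ Z (map lift L) c
  Z-lower-suc L c = trans
    (colourings-map lower (λ _ _ → refl) L (palette (suc c)))
    (sym (colourings-map lift (λ _ _ → refl) L (palette c)))

  module _ (k : ℕ) (IH : ∀ L → length L ≡ k → ∀ n → 0ℤ ≤ Δ^ (suc k) (Z L) n) where

    -- Used for lists of `k+1` vertices, where it is one `Δ` short of the goal. The exponent is the
    -- one that `IH` provides for `k` vertices.
    H : List (V × Bool) → PowerSeries
    H L = Δ^ (suc k) (Z L)

    length-delete : ∀ P {x : V × Bool} Q → length (P ++ x ∷ Q) ≡ suc k → length (P ++ Q) ≡ k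
    length-delete P {x} Q e = ℕ.suc-injective (trans (sym (length-++-sucʳ P x Q)) e)

    length-exchange : ∀ P {x y : V × Bool} Q → length (P ++ x ∷ Q) ≡ suc k → length (P ++ y ∷ Q) ≡ suc k
    length-exchange P {x} {y} Q e =
      trans (length-++-sucʳ P y Q) (trans (sym (length-++-sucʳ P x Q)) e)

    -- By `Z-flip` the difference of the two sides is `H` of a list with one vertex fewer, to which
    -- `IH` applies.
    H-flip : ∀ P m Q → length (P ++ (m , true) ∷ Q) ≡ suc k → ∀ n →
      H (P ++ (m , false) ∷ Q) n ≤ H (P ++ (m , true) ∷ Q) n
    H-flip P m Q e n = ℤ.0≤i-j⇒j≤i (subst (0ℤ ≤_) difference
      (IH R (trans (length-map (lowerNeighbours m) (P ++ Q)) (length-delete P Q e)) n))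
      where
      R = map (lowerNeighbours m) (P ++ Q)
      cancel : ∀ y z → z ≡ z + y - y
      cancel = solve-∀
      difference : H R n ≡ H (P ++ (m , true) ∷ Q) n - H (P ++ (m , false) ∷ Q) n
      difference = trans
        (Δ^-cong (suc k) (λ c → trans (cancel (Z (P ++ (m , false) ∷ Q) c) (Z R c))
          (cong (_- Z (P ++ (m , false) ∷ Q) c) (sym (Z-flip P m Q c)))) n)
        (Δ^-minus (suc k) (Z (P ++ (m , true) ∷ Q)) (Z (P ++ (m , false) ∷ Q)) n)

    -- Flags are lowered one at a time by `H-flip`. The prefix `P` collects the entries already
    -- treated, since a flip may occur at any position.
    H-lower : ∀ P L → length (P ++ L) ≡ suc k → ∀ n → H (P ++ map lower L) n ≤ H (P ++ L) n
    H-lower P []            e n = ℤ.≤-refl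
    H-lower P ((v , t) ∷ L) e n = ℤ.≤-trans
      (subst₂ (λ M N → H M n ≤ H N n) (∷ʳ-++ P _ (map lower L)) (∷ʳ-++ P _ L)
        (H-lower (P ∷ʳ (v , false)) L
          (trans (cong length (∷ʳ-++ P _ L)) (length-exchange P L e)) n))
      (step t e)
      where
      step : ∀ t → length (P ++ (v , t) ∷ L) ≡ suc k →
        H (P ++ (v , false) ∷ L) n ≤ H (P ++ (v , t) ∷ L) n
      step false e = ℤ.≤-refl
      step true  e = H-flip P v L e n

    H-lift : ∀ P L → length (P ++ L) ≡ suc k → ∀ n → H (P ++ L) n ≤ H (P ++ map lift L) n
    H-lift P []            e n = ℤ.≤-refl
    H-lift P ((v , t) ∷ L) e n = ℤ.≤-trans
      (step t e)
      (subst₂ (λ M N → H M n ≤ H N n) (∷ʳ-++ P _ L) (∷ʳ-++ P _ (map lift L))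
        (H-lift (P ∷ʳ (v , true)) L
          (trans (cong length (∷ʳ-++ P _ L)) (length-exchange P L e)) n))
      where
      step : ∀ t → length (P ++ (v , t) ∷ L) ≡ suc k →
        H (P ++ (v , t) ∷ L) n ≤ H (P ++ (v , true) ∷ L) n
      step true  e = ℤ.≤-refl
      step false e = H-flip P v L (length-exchange P L e) n

    H-lower-shift : ∀ x L → H (map lower (x ∷ L)) ≗ shift (H (map lift (x ∷ L)))
    H-lower-shift x L n = trans
      (Δ^-cong (suc k) Z-shift n) (Δ^-shift (suc k) (Z (map lift (x ∷ L))) n)
      where
      Z-shift : Z (map lower (x ∷ L)) ≗ shift (Z (map lift (x ∷ L)))
      -- With all flags lowered the palettes at 0 are empty, so a nonempty list has no colouring
      -- there. This is why the list has the form `x ∷ L`.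
      Z-shift zero    = refl
      Z-shift (suc c) = Z-lower-suc (x ∷ L) c

    shift-mono : ∀ {a b} → (∀ n → a n ≤ b n) → ∀ n → shift a n ≤ shift b n
    shift-mono le zero    = ℤ.≤-refl
    shift-mono le (suc n) = le n

    -- Z of the lowered list is the shift of Z of the lifted one, so that
    -- H L lies between shift (H (lift L)) and H (lift L).
    Z-nonneg-step : ∀ L → length L ≡ suc k → ∀ n → 0ℤ ≤ Δ (H L) n
    Z-nonneg-step (x ∷ L) e n = ℤ.i≤j⇒0≤j-i (ℤ.≤-trans
      (shift-mono (H-lift [] (x ∷ L) e) n)
      (ℤ.≤-trans (ℤ.≤-reflexive (sym (H-lower-shift x L n))) (H-lower [] (x ∷ L) e n)))

  Z-nonneg : ∀ k L → length L ≡ k → ∀ n → 0ℤ ≤ Δ^ (suc k) (Z L) n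
  -- `Z []` is constantly 1, so its difference is 1 at 0 and 0 afterwards.
  Z-nonneg zero    [] e zero    = +≤+ z≤n
  Z-nonneg zero    [] e (suc n) = +≤+ z≤n
  Z-nonneg (suc k) L  e         = Z-nonneg-step k (Z-nonneg k) L e

-- Proper colourings as sums over vectors

𝟙 : {P : Set} → Dec P → ℤ
𝟙 p = if does p then 1ℤ else 0ℤ

𝟙-cong : {P Q : Set} (p : Dec P) (q : Dec Q) → P ⇔ Q → 𝟙 p ≡ 𝟙 q
𝟙-cong p q e = cong (if_then 1ℤ else 0ℤ) (does-⇔ e p q)

𝟙-× : {P Q : Set} (p : Dec P) (q : Dec Q) → 𝟙 (p ×-dec q) ≡ 𝟙 p * 𝟙 q
𝟙-× p q with does p
... | true  = sym (ℤ.*-identityˡ (𝟙 q))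
... | false = refl

𝟙-¬ : {P : Set} (p : Dec P) → ¬ P → 𝟙 p ≡ 0ℤ
𝟙-¬ p ¬p = cong (if_then 1ℤ else 0ℤ) (dec-false p ¬p)

𝟙-yes : {P : Set} (p : Dec P) → P → 𝟙 p ≡ 1ℤ
𝟙-yes p x = cong (if_then 1ℤ else 0ℤ) (dec-true p x)

𝟙-* : {P : Set} (p : Dec P) (x : ℤ) → 𝟙 p * x ≡ (if does p then x else 0ℤ)
𝟙-* p x with does p
... | true  = ℤ.*-identityˡ x
... | false = refl

∑∈-* : ∀ {A : Set} (x : ℤ) (S : List A) f → ∑∈ S (λ c → x * f c) ≡ x * ∑∈ S f
∑∈-* x []      f = sym (ℤ.*-zeroʳ x)
∑∈-* x (c ∷ S) f = trans (cong (_+_ (x * f c)) (∑∈-* x S f)) (sym (ℤ.*-distribˡ-+ x (f c) (∑∈ S f)))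

∑∈-downFrom-const : ∀ n x → ∑∈ (downFrom n) (λ _ → x) ≡ + n * x
∑∈-downFrom-const zero    x = refl
∑∈-downFrom-const (suc n) x = trans (cong (_+_ x) (∑∈-downFrom-const n x)) (lemma x (+ n))
  where
  lemma : ∀ x k → x + k * x ≡ (1ℤ + k) * x
  lemma = solve-∀

∑∈-downFrom-δ : ∀ {y n} → y ℕ.< n → (f : ℕ → ℤ) →
  ∑∈ (downFrom n) (λ c → 𝟙 (c ℕ.≟ y) * f c) ≡ f y
∑∈-downFrom-δ {y} {suc n} (s≤s y≤n) f with n ℕ.≟ y
... | no  n≢y = trans
  (cong₂ _+_ (cong (_* f n) (𝟙-¬ (n ℕ.≟ y) n≢y)) (∑∈-downFrom-δ (ℕ.≤∧≢⇒< y≤n (n≢y ∘ sym)) f))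
  (ℤ.+-identityˡ (f y))
... | yes refl = trans
  (cong₂ _+_ (trans (cong (_* f n) (𝟙-yes (n ℕ.≟ n) refl)) (ℤ.*-identityˡ (f n))) (above ℕ.≤-refl))
  (ℤ.+-identityʳ (f n))
  where
  above : ∀ {m} → m ℕ.≤ n → ∑∈ (downFrom m) (λ c → 𝟙 (c ℕ.≟ n) * f c) ≡ 0ℤ
  above {zero}  _   = refl
  above {suc m} m<n = cong₂ _+_
    (cong (_* f m) (𝟙-¬ (m ℕ.≟ n) (ℕ.<⇒≢ m<n))) (above (ℕ.<⇒≤ m<n))

∑∈-downFrom : ∀ n (f : ℕ → ℤ) → ∑[ i < n ] f (toℕ i) ≡ ∑∈ (downFrom n) f
∑∈-downFrom zero    f = refl
∑∈-downFrom (suc n) f = begin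
  ∑[ i < suc n ] f (toℕ i)       ≡⟨ ∑-last f n ⟩
  ∑[ i < n ] f (toℕ i) + f n     ≡⟨ ℤ.+-comm _ (f n) ⟩
  f n + ∑[ i < n ] f (toℕ i)     ≡⟨ cong (_+_ (f n)) (∑∈-downFrom n f) ⟩
  f n + ∑∈ (downFrom n) f        ∎

-- Colourings are vectors of naturals rather than maps into `Fin n`, so that removing a colour from
-- a list changes no type.
∑Vec : ∀ {k} → (Fin k → List ℕ) → (Vec ℕ k → ℤ) → ℤ
∑Vec {zero}  S F = F []
∑Vec {suc k} S F = ∑∈ (S zero) (λ c → ∑Vec (S ∘ suc) (λ xs → F (c ∷ xs)))

∑Vec-cong : ∀ {k} (S : Fin k → List ℕ) {F G} → F ≗ G → ∑Vec S F ≡ ∑Vec S G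
∑Vec-cong {zero}  S e = e []
∑Vec-cong {suc k} S e = ∑∈-cong (S zero) (λ c → ∑Vec-cong (S ∘ suc) (λ xs → e (c ∷ xs)))

∑Vec-+ : ∀ {k} (S : Fin k → List ℕ) F G → ∑Vec S (λ xs → F xs + G xs) ≡ ∑Vec S F + ∑Vec S G
∑Vec-+ {zero}  S F G = refl
∑Vec-+ {suc k} S F G = trans
  (∑∈-cong (S zero) (λ c → ∑Vec-+ (S ∘ suc) (F ∘ (c ∷_)) (G ∘ (c ∷_))))
  (∑∈-+ (S zero) _ _)

∑Vec-* : ∀ {k} x (S : Fin k → List ℕ) F → ∑Vec S (λ xs → x * F xs) ≡ x * ∑Vec S F
∑Vec-* {zero}  x S F = refl
∑Vec-* {suc k} x S F = trans
  (∑∈-cong (S zero) (λ c → ∑Vec-* x (S ∘ suc) (F ∘ (c ∷_))))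
  (∑∈-* x (S zero) _)

∑Vec-zero : ∀ {k} (S : Fin k → List ℕ) {F} → (∀ xs → F xs ≡ 0ℤ) → ∑Vec S F ≡ 0ℤ
∑Vec-zero S {F} e = trans (∑Vec-cong S e) (∑Vec-* 0ℤ S (λ _ → 0ℤ))

∑∈-∑Vec-comm : ∀ {A : Set} {k} (T : List A) (S : Fin k → List ℕ) (F : A → Vec ℕ k → ℤ) →
  ∑∈ T (λ c → ∑Vec S (F c)) ≡ ∑Vec S (λ xs → ∑∈ T (λ c → F c xs))
∑∈-∑Vec-comm {k = zero}  T S F = refl
∑∈-∑Vec-comm {k = suc k} T S F = trans
  (∑∈-comm T (S zero) _)
  (∑∈-cong (S zero) (λ d → ∑∈-∑Vec-comm T (S ∘ suc) (λ c xs → F c (d ∷ xs))))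

downFrom-cong : ∀ n {f g : ℕ → ℤ} → (∀ {c} → c ℕ.< n → f c ≡ g c) → ∑∈ (downFrom n) f ≡ ∑∈ (downFrom n) g
downFrom-cong zero    e = refl
downFrom-cong (suc n) e = cong₂ _+_ (e ℕ.≤-refl) (downFrom-cong n (λ c<n → e (ℕ.m<n⇒m<1+n c<n)))

-- The bound on the entries is what lets a sum over all colours collapse to the colour of a given
-- vertex.
∑Vec-downFrom-cong : ∀ {k} n {F G : Vec ℕ k → ℤ} →
  (∀ xs → (∀ i → lookup xs i ℕ.< n) → F xs ≡ G xs) →
  ∑Vec (λ _ → downFrom n) F ≡ ∑Vec (λ _ → downFrom n) G
∑Vec-downFrom-cong {zero}  n e = e [] λ ()
∑Vec-downFrom-cong {suc k} n e = downFrom-cong n λ {c} c<n →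
  ∑Vec-downFrom-cong n λ xs xs<n → e (c ∷ xs) λ { zero → c<n ; (suc i) → xs<n i }

∑-++ : ∀ m n (f : Fin (m ℕ.+ n) → ℤ) →
  ∑[ k < m ℕ.+ n ] f k ≡ ∑[ i < m ] f (i ↑ˡ n) + ∑[ j < n ] f (m ↑ʳ j)
∑-++ zero    n f = sym (ℤ.+-identityˡ _)
∑-++ (suc m) n f = trans (cong (_+_ (f zero)) (∑-++ m n (f ∘ suc))) (sym (ℤ.+-assoc (f zero) _ _))

∑-combine : ∀ m n (f : Fin (m ℕ.* n) → ℤ) →
  ∑[ k < m ℕ.* n ] f k ≡ ∑[ i < m ] ∑[ j < n ] f (combine i j)
∑-combine zero    n f = refl
∑-combine (suc m) n f = trans (∑-++ n (m ℕ.* n) f)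
  (cong (_+_ (∑[ j < n ] f (j ↑ˡ m ℕ.* n))) (∑-combine m n (f ∘ (n ↑ʳ_))))

-- `finToFun` reads base-`n` digits: the quotient by `n ^ d` is the colour of the first vertex and
-- the remainder encodes the other colours.
∑-finToFun : ∀ d n (F : Vec ℕ d → ℤ) →
  ∑[ k < n ℕ.^ d ] F (tabulate (toℕ ∘ finToFun k)) ≡ ∑Vec (λ _ → downFrom n) F
∑-finToFun zero    n F = ℤ.+-identityʳ (F [])
∑-finToFun (suc d) n F = begin
  ∑[ k < n ℕ.* n ℕ.^ d ] F (tabulate (toℕ ∘ finToFun k))
    ≡⟨ ∑-combine n (n ℕ.^ d) (λ k → F (tabulate (toℕ ∘ finToFun {n} {suc d} k))) ⟩
  ∑[ i < n ] ∑[ j < n ℕ.^ d ] F (tabulate (toℕ ∘ finToFun {n} {suc d} (combine i j)))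
    ≡⟨ sum-cong-≗ {n} (λ i → sum-cong-≗ {n ℕ.^ d} (λ j → cong F (expand i j))) ⟩
  ∑[ i < n ] ∑[ j < n ℕ.^ d ] F (toℕ i ∷ tabulate (toℕ ∘ finToFun j))
    ≡⟨ sum-cong-≗ {n} (λ i → ∑-finToFun d n (λ xs → F (toℕ i ∷ xs))) ⟩
  ∑[ i < n ] ∑Vec (λ _ → downFrom n) (λ xs → F (toℕ i ∷ xs))
    ≡⟨ ∑∈-downFrom n _ ⟩
  ∑Vec (λ _ → downFrom n) F ∎
  where
  expand : ∀ (i : Fin n) (j : Fin (n ℕ.^ d)) →
    tabulate (toℕ ∘ finToFun {n} {suc d} (combine i j)) ≡ toℕ i ∷ tabulate (toℕ ∘ finToFun j)
  expand i j = cong₂ _∷_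
    (cong (toℕ ∘ proj₁) (remQuot-combine i j))
    (tabulate-cong (λ l → cong (λ r → toℕ (finToFun (proj₂ r) l)) (remQuot-combine i j)))

count-tabulate : ∀ {A : Set} {P : Pred A 0ℓ} (P? : Decidable P) m (f : Fin m → A) →
  + count P? (tabulate f) ≡ ∑[ i < m ] 𝟙 (P? (f i))
count-tabulate P? zero    f = refl
count-tabulate P? (suc m) f with does (P? (f zero))
... | true  = cong (_+_ 1ℤ) (count-tabulate P? m (f ∘ suc))
... | false = trans (count-tabulate P? m (f ∘ suc)) (sym (ℤ.+-identityˡ _))

-- Contractions can create loops, so these are allowed; a graph with a loop
-- has no proper colouring.
record LoopGraph (k : ℕ) : Set₁ where
  field
    Adj     : Rel (Fin k) 0ℓ
    adj?    : Binary.Decidable Adj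
    adj-sym : Binary.Symmetric Adj

open LoopGraph

ProperVec : ∀ {k} → LoopGraph k → Vec ℕ k → Set
ProperVec G xs = ∀ i j → Adj G i j → lookup xs i ≢ lookup xs j

properVec? : ∀ {k} (G : LoopGraph k) (xs : Vec ℕ k) → Dec (ProperVec G xs)
properVec? G xs = all? λ i → all? λ j → adj? G i j →-dec ¬? (lookup xs i ℕ.≟ lookup xs j)

χ : ∀ {k} → LoopGraph k → PowerSeries
χ G n = ∑Vec (λ _ → downFrom n) (λ xs → 𝟙 (properVec? G xs))

Loopless : ∀ {k} → LoopGraph k → Set
Loopless G = ∀ i → ¬ Adj G i i

χ-loop : ∀ {k} (G : LoopGraph k) i → Adj G i i → ∀ n → χ G n ≡ 0ℤ
χ-loop G i loop n = ∑Vec-zero (λ _ → downFrom n) λ xs →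
  𝟙-¬ (properVec? G xs) (λ proper → proper i i loop refl)

induced : ∀ {k l} → (Fin l → Fin k) → LoopGraph k → LoopGraph l
induced ι G .Adj i j     = Adj G (ι i) (ι j)
induced ι G .adj? i j    = adj? G (ι i) (ι j)
induced ι G .adj-sym     = adj-sym G

fromSimple : ∀ {d} → SimpleGraph d → LoopGraph d
fromSimple G = record
  { Adj = SimpleGraph.Adj G ; adj? = SimpleGraph.adj? G ; adj-sym = SimpleGraph.sym G }

chromatic-χ : ∀ {d} (G : SimpleGraph d) → chromaticSeries G ≗ χ (fromSimple G)
chromatic-χ {d} G n = begin
  + count (proper? G) (tabulate {n = n ℕ.^ d} finToFun)
    ≡⟨ count-tabulate (proper? G) (n ℕ.^ d) finToFun ⟩
  ∑[ k < n ℕ.^ d ] 𝟙 (proper? G (finToFun {n} {d} k))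
    ≡⟨ sum-cong-≗ {n ℕ.^ d} (λ k → agree (finToFun k)) ⟩
  ∑[ k < n ℕ.^ d ] 𝟙 (properVec? (fromSimple G) (tabulate (toℕ ∘ finToFun {n} {d} k)))
    ≡⟨ ∑-finToFun d n _ ⟩
  χ (fromSimple G) n ∎
  where
  agree : (φ : Fin d → Fin n) →
    𝟙 (proper? G φ) ≡ 𝟙 (properVec? (fromSimple G) (tabulate (toℕ ∘ φ)))
  agree φ = 𝟙-cong (proper? G φ) (properVec? (fromSimple G) (tabulate (toℕ ∘ φ))) $ mk⇔
    (λ proper i j a e → proper i j a (toℕ-injective
      (trans (sym (lookup∘tabulate (toℕ ∘ φ) i)) (trans e (lookup∘tabulate (toℕ ∘ φ) j)))))
    (λ proper i j a e → proper i j a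
      (trans (lookup∘tabulate (toℕ ∘ φ) i) (trans (cong toℕ e) (sym (lookup∘tabulate (toℕ ∘ φ) j)))))

module _ {k} (B : Pred (Fin k) 0ℓ) (B? : Decidable B) where

  Avoids : ℕ → Vec ℕ k → Set
  Avoids c xs = ∀ i → B i → c ≢ lookup xs i

  avoids? : ∀ c xs → Dec (Avoids c xs)
  avoids? c xs = all? λ i → B? i →-dec ¬? (c ℕ.≟ lookup xs i)

properVec-∷ : ∀ {k} (G : LoopGraph (suc k)) → ¬ Adj G zero zero → ∀ c xs →
  𝟙 (properVec? G (c ∷ xs))
  ≡ 𝟙 (avoids? (λ i → Adj G zero (suc i)) (λ i → adj? G zero (suc i)) c xs) * 𝟙 (properVec? (induced suc G) xs)
properVec-∷ G noloop c xs = trans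
  (𝟙-cong (properVec? G (c ∷ xs)) (a? ×-dec p?) (mk⇔
    (λ proper → (λ i → proper zero (suc i)) , (λ i j → proper (suc i) (suc j)))
    (λ { (avoids , proper) → λ
      { zero    zero    a _ → noloop a
      ; zero    (suc j) a e → avoids j a e
      ; (suc i) zero    a e → avoids i (adj-sym G a) (sym e)
      ; (suc i) (suc j)     → proper i j } })))
  (𝟙-× a? p?)
  where
  a? = avoids? (λ i → Adj G zero (suc i)) (λ i → adj? G zero (suc i)) c xs
  p? = properVec? (induced suc G) xs

∑∈-remove : ∀ {P : Set} (p : Dec P) c S (f : ℕ → ℤ) →
  ∑∈ (if does p then remove c S else S) f ≡ ∑∈ S (λ d → 𝟙 (p →-dec ¬? (c ℕ.≟ d)) * f d)
∑∈-remove p c S f with does p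
... | true  = trans (∑∈-filter (differs? c) S f) (∑∈-cong S (λ d → sym (𝟙-* (differs? c d) (f d))))
... | false = ∑∈-cong S (λ d → sym (ℤ.*-identityˡ (f d)))

-- Trades a restriction of the colour lists for an indicator factor, the link between one step of
-- `colourings` and properness.
∑Vec-remove : ∀ {k} (B : Pred (Fin k) 0ℓ) (B? : Decidable B) c S F →
  ∑Vec (λ i → if does (B? i) then remove c (S i) else S i) F
  ≡ ∑Vec S (λ xs → 𝟙 (avoids? B B? c xs) * F xs)
∑Vec-remove {zero}  B B? c S F = sym (ℤ.*-identityˡ (F []))
∑Vec-remove {suc k} B B? c S F = begin
  ∑∈ (if does (B? zero) then remove c (S zero) else S zero)
     (λ d → ∑Vec (λ i → if does (B? (suc i)) then remove c (S (suc i)) else S (suc i)) (F ∘ (d ∷_)))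
    ≡⟨ ∑∈-cong (if does (B? zero) then remove c (S zero) else S zero)
         (λ d → ∑Vec-remove (B ∘ suc) (B? ∘ suc) c (S ∘ suc) (F ∘ (d ∷_))) ⟩
  ∑∈ (if does (B? zero) then remove c (S zero) else S zero)
     (λ d → ∑Vec (S ∘ suc) (λ xs → 𝟙 (tail? xs) * F (d ∷ xs)))
    ≡⟨ ∑∈-remove (B? zero) c (S zero) _ ⟩
  ∑∈ (S zero) (λ d → 𝟙 (head? d) * ∑Vec (S ∘ suc) (λ xs → 𝟙 (tail? xs) * F (d ∷ xs)))
    ≡⟨ ∑∈-cong (S zero) (λ d → trans
         (sym (∑Vec-* (𝟙 (head? d)) (S ∘ suc) (λ xs → 𝟙 (tail? xs) * F (d ∷ xs))))
         (∑Vec-cong (S ∘ suc) (λ xs → trans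
           (sym (ℤ.*-assoc (𝟙 (head? d)) (𝟙 (tail? xs)) (F (d ∷ xs))))
           (cong (_* F (d ∷ xs)) (split d xs))))) ⟩
  ∑∈ (S zero) (λ d → ∑Vec (S ∘ suc) (λ xs → 𝟙 (avoids? B B? c (d ∷ xs)) * F (d ∷ xs))) ∎
  where
  head? : ∀ d → Dec (B zero → c ≢ d)
  head? d = B? zero →-dec ¬? (c ℕ.≟ d)
  tail? : ∀ xs → Dec (Avoids (B ∘ suc) (B? ∘ suc) c xs)
  tail? xs = avoids? (B ∘ suc) (B? ∘ suc) c xs
  split : ∀ d xs → 𝟙 (head? d) * 𝟙 (tail? xs) ≡ 𝟙 (avoids? B B? c (d ∷ xs))
  split d xs = trans (sym (𝟙-× (head? d) (tail? xs)))
    (𝟙-cong (head? d ×-dec tail? xs) (avoids? B B? c (d ∷ xs)) (mk⇔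
      (λ { (h , t) → λ { zero → h ; (suc i) → t i } })
      (λ a → a zero , a ∘ suc)))

-- Nonnegativity for graphs that may have loops

module _ {k} (G : LoopGraph k) where

  does-adj-sym : ∀ i j → does (adj? G i j) ≡ does (adj? G j i)
  does-adj-sym i j = does-⇔ (mk⇔ (adj-sym G) (adj-sym G)) (adj? G i j) (adj? G j i)

  open Nonnegativity (λ i j → does (adj? G i j)) does-adj-sym
  open ListColouring adj

  module _ (loopless : Loopless G) where

    -- Stated for an arbitrary enumeration `ι`, so that the induction can pass to its tail.
    colourings-χ : ∀ {l} (ι : Fin l → Fin k × Bool) g →
      colourings (List.tabulate ι) g
      ≡ ∑Vec (g ∘ ι) (λ xs → 𝟙 (properVec? (induced (proj₁ ∘ ι) G) xs))
    colourings-χ {zero}  ι g = refl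
    colourings-χ {suc l} ι g = ∑∈-cong (g (ι zero)) λ c → begin
      colourings (List.tabulate (ι ∘ suc)) (forbid (ι zero) c g)
        ≡⟨ colourings-χ (ι ∘ suc) (forbid (ι zero) c g) ⟩
      ∑Vec (forbid (ι zero) c g ∘ ι ∘ suc) (λ xs → 𝟙 (properVec? (induced suc Gι) xs))
        ≡⟨ ∑Vec-remove (λ i → Adj Gι zero (suc i)) (λ i → adj? Gι zero (suc i)) c (g ∘ ι ∘ suc) _ ⟩
      ∑Vec (g ∘ ι ∘ suc) (λ xs →
        𝟙 (avoids? (λ i → Adj Gι zero (suc i)) (λ i → adj? Gι zero (suc i)) c xs)
        * 𝟙 (properVec? (induced suc Gι) xs))
        ≡⟨ ∑Vec-cong (g ∘ ι ∘ suc) (properVec-∷ Gι (loopless (proj₁ (ι zero))) c) ⟨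
      ∑Vec (g ∘ ι ∘ suc) (λ xs → 𝟙 (properVec? Gι (c ∷ xs))) ∎
      where
      Gι = induced (proj₁ ∘ ι) G

  hPoly : PowerSeries
  hPoly = Δ^ (suc k) (χ G)

  hPoly-loop : ∀ i → Adj G i i → ∀ n → hPoly n ≡ 0ℤ
  hPoly-loop i loop = Δ^-zero (suc k) (χ-loop G i loop)

  hPoly-nonneg : ∀ n → 0ℤ ≤ hPoly n
  -- A list colouring never compares a vertex with itself, so it ignores loops. With a loop `χ`
  -- vanishes and the claim is immediate.
  hPoly-nonneg n with any? (λ i → adj? G i i)
  ... | yes (i , loop) = ℤ.≤-reflexive (sym (hPoly-loop i loop n))
  ... | no  noloop     = subst (0ℤ ≤_)
    -- With all flags lowered every palette at `c` is `downFrom c`, so `Z` is `χ`.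
    (Δ^-cong (suc k) (λ c → colourings-χ (λ i a → noloop (i , a)) (_, false) (palette c)) n)
    (Z-nonneg k (List.tabulate (_, false)) (length-tabulate (_, false)) n)

-- Deletion and contraction at the first vertex

module _ {k : ℕ} where

  open DecMembership (Fin._≟_ {k}) using (_∈?_)

  AvoidsAll : List (Fin k) → ℕ → Vec ℕ k → Set
  AvoidsAll N c xs = All (λ j → c ≢ lookup xs j) N

  avoidsAll? : ∀ N c xs → Dec (AvoidsAll N c xs)
  avoidsAll? N c xs = All.all? (λ j → ¬? (c ℕ.≟ lookup xs j)) N

  -- The chromatic series of `G` with a new vertex, coloured `c`, joined to the vertices in `N`.
  -- Keeping `N` as a list allows the edges to be added one by one.
  coneχ : List (Fin k) → LoopGraph k → PowerSeries
  coneχ N G n = ∑∈ (downFrom n) λ c →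
    ∑Vec (λ _ → downFrom n) (λ xs → 𝟙 (avoidsAll? N c xs) * 𝟙 (properVec? G xs))

  -- The contraction of the edge from the new vertex to `v`: the merged vertex inherits the
  -- neighbours `N`, and gets a loop if `v` lies in `N`.
  attach : Fin k → List (Fin k) → LoopGraph k → LoopGraph k
  attach v N G .Adj i j  = Adj G i j ⊎ (i ≡ v × j ∈ N) ⊎ (j ≡ v × i ∈ N)
  attach v N G .adj? i j = adj? G i j ⊎-dec (i Fin.≟ v ×-dec j ∈? N) ⊎-dec (j Fin.≟ v ×-dec i ∈? N)
  attach v N G .adj-sym (inj₁ a)        = inj₁ (adj-sym G a)
  attach v N G .adj-sym (inj₂ (inj₁ s)) = inj₂ (inj₂ s)
  attach v N G .adj-sym (inj₂ (inj₂ s)) = inj₂ (inj₁ s)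

  properVec-attach : ∀ v N G xs → 𝟙 (properVec? (attach v N G) xs)
    ≡ 𝟙 (avoidsAll? N (lookup xs v) xs) * 𝟙 (properVec? G xs)
  properVec-attach v N G xs = trans
    (𝟙-cong (properVec? (attach v N G) xs) (avoid? ×-dec properVec? G xs) (mk⇔
      (λ proper → All.tabulate (λ j∈N → proper v _ (inj₂ (inj₁ (refl , j∈N))))
                , (λ i j a → proper i j (inj₁ a)))
      (λ { (avoids , proper) i j → λ
        { (inj₁ a)                   → proper i j a
        ; (inj₂ (inj₁ (refl , j∈N))) → All.lookup avoids j∈N
        ; (inj₂ (inj₂ (refl , i∈N))) → All.lookup avoids i∈N ∘ sym } })))
    (𝟙-× avoid? (properVec? G xs))
    where
    avoid? = avoidsAll? N (lookup xs v) xs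

  -- Split by whether the new vertex shares the colour of `v`.
  avoidsAll-∷ : ∀ v N c xs →
    𝟙 (avoidsAll? N c xs) ≡ 𝟙 (avoidsAll? (v ∷ N) c xs) + 𝟙 (c ℕ.≟ lookup xs v) * 𝟙 (avoidsAll? N c xs)
  avoidsAll-∷ v N c xs = trans (split (c ℕ.≟ lookup xs v) (avoidsAll? N c xs))
    (cong (_+ 𝟙 (c ℕ.≟ lookup xs v) * 𝟙 (avoidsAll? N c xs))
      (𝟙-cong (¬? (c ℕ.≟ lookup xs v) ×-dec avoidsAll? N c xs) (avoidsAll? (v ∷ N) c xs)
        (mk⇔ (λ { (a , as) → a ∷ as }) (λ { (a ∷ as) → a , as }))))
    where
    split : {P Q : Set} (p : Dec P) (q : Dec Q) → 𝟙 q ≡ 𝟙 (¬? p ×-dec q) + 𝟙 p * 𝟙 q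
    split (yes _) q = sym (trans (ℤ.+-identityˡ _) (ℤ.*-identityˡ (𝟙 q)))
    split (no _)  q = sym (ℤ.+-identityʳ (𝟙 q))

  coneχ-[] : ∀ G → coneχ [] G ≗ θ (χ G)
  coneχ-[] G n = trans
    (∑∈-cong (downFrom n) (λ c → ∑Vec-cong (λ _ → downFrom n) (λ xs → ℤ.*-identityˡ (𝟙 (properVec? G xs)))))
    (∑∈-downFrom-const n (χ G n))

  -- Deletion-contraction for the edge between the new vertex and `v`: colourings without the edge
  -- either separate its ends or identify them.
  coneχ-∷ : ∀ v N G → coneχ (v ∷ N) G ≗ λ n → coneχ N G n - χ (attach v N G) n
  coneχ-∷ v N G n = begin
    coneχ (v ∷ N) G n
      ≡⟨ lemma (coneχ (v ∷ N) G n) (χ (attach v N G) n) ⟩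
    coneχ (v ∷ N) G n + χ (attach v N G) n - χ (attach v N G) n
      ≡⟨ cong (_- χ (attach v N G) n) deletion ⟨
    coneχ N G n - χ (attach v N G) n ∎
    where
    lemma : ∀ x y → x ≡ x + y - y
    lemma = solve-∀
    S = λ (_ : Fin k) → downFrom n
    with-v equal-v : ℕ → Vec ℕ k → ℤ
    with-v  c xs = 𝟙 (avoidsAll? (v ∷ N) c xs) * 𝟙 (properVec? G xs)
    equal-v c xs = 𝟙 (avoidsAll? N c xs) * 𝟙 (properVec? G xs)
    ring : ∀ y z x w → (y + z * x) * w ≡ y * w + z * (x * w)
    ring = solve-∀
    contraction : ∑∈ (downFrom n) (λ c → ∑Vec S (λ xs → 𝟙 (c ℕ.≟ lookup xs v) * equal-v c xs))
      ≡ χ (attach v N G) n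
    contraction = begin
      ∑∈ (downFrom n) (λ c → ∑Vec S (λ xs → 𝟙 (c ℕ.≟ lookup xs v) * equal-v c xs))
        ≡⟨ ∑∈-∑Vec-comm (downFrom n) S (λ c xs → 𝟙 (c ℕ.≟ lookup xs v) * equal-v c xs) ⟩
      ∑Vec S (λ xs → ∑∈ (downFrom n) (λ c → 𝟙 (c ℕ.≟ lookup xs v) * equal-v c xs))
        -- Only `c = lookup xs v` survives in the inner sum, and it is among the colours because it
        -- is below `n`.
        ≡⟨ ∑Vec-downFrom-cong n (λ xs xs<n → trans
             (∑∈-downFrom-δ (xs<n v) (λ c → equal-v c xs)) (sym (properVec-attach v N G xs))) ⟩
      χ (attach v N G) n ∎
    deletion : coneχ N G n ≡ coneχ (v ∷ N) G n + χ (attach v N G) n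
    deletion = begin
      coneχ N G n
        ≡⟨ ∑∈-cong (downFrom n) (λ c → trans
             (∑Vec-cong S (λ xs → trans
               (cong (_* 𝟙 (properVec? G xs)) (avoidsAll-∷ v N c xs))
               (ring (𝟙 (avoidsAll? (v ∷ N) c xs)) (𝟙 (c ℕ.≟ lookup xs v))
                 (𝟙 (avoidsAll? N c xs)) (𝟙 (properVec? G xs)))))
             (∑Vec-+ S (with-v c) (λ xs → 𝟙 (c ℕ.≟ lookup xs v) * equal-v c xs))) ⟩
      ∑∈ (downFrom n) (λ c →
        ∑Vec S (with-v c) + ∑Vec S (λ xs → 𝟙 (c ℕ.≟ lookup xs v) * equal-v c xs))
        ≡⟨ ∑∈-+ (downFrom n) _ _ ⟩
      coneχ (v ∷ N) G n + ∑∈ (downFrom n) (λ c → ∑Vec S (λ xs → 𝟙 (c ℕ.≟ lookup xs v) * equal-v c xs))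
        ≡⟨ cong (_+_ (coneχ (v ∷ N) G n)) contraction ⟩
      coneχ (v ∷ N) G n + χ (attach v N G) n ∎

neighbours₀ : ∀ {k} → LoopGraph (suc k) → List (Fin k)
neighbours₀ G = filter (λ i → adj? G zero (suc i)) (allFin _)

χ-cone : ∀ {k} (G : LoopGraph (suc k)) → ¬ Adj G zero zero →
  χ G ≗ coneχ (neighbours₀ G) (induced suc G)
χ-cone {k} G noloop n = ∑∈-cong (downFrom n) λ c → ∑Vec-cong (λ _ → downFrom n) λ xs → trans
  (properVec-∷ G noloop c xs)
  (cong (_* 𝟙 (properVec? (induced suc G) xs))
    (𝟙-cong (avoids? B B? c xs) (avoidsAll? (neighbours₀ G) c xs) (mk⇔
      (λ a → All.tabulate (λ {i} i∈N → a i (proj₂ (∈-filter⁻ B? {xs = allFin k} i∈N))))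
      (λ as i b → All.lookup as (∈-filter⁺ B? (∈-allFin i) b)))))
  where
  B = λ i → Adj G zero (suc i)
  B? = λ i → adj? G zero (suc i)

-- The gap inequalities as an inductive invariant

-- The range is `i ≤ d` rather than half of it, because the recursion for an isolated vertex derives
-- the gap at `i+1` from those at `i` and `i+1` of the smaller graph.
record HVector (d : ℕ) (h : PowerSeries) : Set where
  field
    vanishes : ∀ i → d ℕ.< i → h i ≡ 0ℤ
    gaps     : ∀ i → i ℕ.≤ d → 0ℤ ≤ gap h d i

open HVector

HVector-cong : ∀ {d h g} → h ≗ g → HVector d g → HVector d h
HVector-cong e H .vanishes i d<i = trans (e i) (vanishes H i d<i)
HVector-cong {d} e H .gaps i i≤d = subst (0ℤ ≤_) (sym (gap-cong d i e)) (gaps H i i≤d)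

HVector-zero : ∀ {d h} → (∀ n → h n ≡ 0ℤ) → HVector d h
HVector-zero e .vanishes i _ = e i
HVector-zero {d} {h} e .gaps i _ = ℤ.≤-reflexive (sym (zero-gap i))
  where
  zero-gap : ∀ i → gap h d i ≡ 0ℤ
  zero-gap zero    = refl
  zero-gap (suc i) = trans (gap-suc h d i) (cong₂ _+_ (zero-gap i) (cong₂ _-_ (e (d ∸ i)) (e i)))

gaps-extended : ∀ {d h} → HVector d h → ∀ i → i ℕ.≤ suc d → 0ℤ ≤ gap h d i
gaps-extended {d} {h} H i i≤1+d with ℕ.m≤n⇒m<n∨m≡n i≤1+d
... | inj₁ (s≤s i≤d) = gaps H i i≤d
... | inj₂ refl      = ℤ.≤-reflexive (sym (gap-total h d))

0≤+ : ∀ {x y} → 0ℤ ≤ x → 0ℤ ≤ y → 0ℤ ≤ x + y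
0≤+ p q = ℤ.+-mono-≤ p q

0≤* : ∀ n {x} → 0ℤ ≤ x → 0ℤ ≤ + n * x
0≤* n {x} p = subst (_≤ + n * x) (ℤ.*-zeroʳ (+ n)) (ℤ.*-monoˡ-≤-nonNeg (+ n) p)

∸-step : ∀ {i k} → i ℕ.< k → k ∸ i ≡ suc (k ∸ suc i)
∸-step (s≤s i≤k) = ℕ.+-∸-assoc 1 i≤k

-- The right side of `Δ^-θ` for `Δ^ (2 ℕ.+ k)`: if `g` belongs to a graph on `k` vertices, this
-- belongs to that graph with an isolated vertex. Its coefficient at `n` is
-- `n g_n + (k+2-n) g_(n-1)`.
weighted : ℕ → PowerSeries → PowerSeries
weighted k g n = + n * Δ g n + + (2 ℕ.+ k) * shift g n

-- The bottom sum is `(k+1)(g_0 + … + g_(i-1)) + i g_i` and the top sum is `(k+1)(g_k + … +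
-- g_(k-i+1)) + (i+1) g_(k-i)`. Rewriting their difference through consecutive gaps makes every term
-- nonnegative when `g` satisfies the invariant and is nonnegative.
gap-weighted : ∀ k g → g (suc k) ≡ 0ℤ → ∀ i → i ℕ.≤ k →
  gap (weighted k g) (suc k) (suc i)
  ≡ + (suc k ∸ i) * gap g k i + + i * gap g k (suc i) + g (k ∸ i)
gap-weighted k g g≡0 zero _ = begin
  gap (weighted k g) (suc k) 1
    ≡⟨ gap-suc (weighted k g) (suc k) 0 ⟩
  0ℤ + (+ suc k * (g (suc k) - g k) + + (2 ℕ.+ k) * g k - (0ℤ + + (2 ℕ.+ k) * 0ℤ))
    ≡⟨ cong (λ x → 0ℤ + (+ suc k * (x - g k) + + (2 ℕ.+ k) * g k - (0ℤ + + (2 ℕ.+ k) * 0ℤ))) g≡0 ⟩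
  0ℤ + (+ suc k * (0ℤ - g k) + + (2 ℕ.+ k) * g k - (0ℤ + + (2 ℕ.+ k) * 0ℤ))
    ≡⟨ ring (+ k) (g k) ⟩
  + suc k * 0ℤ + 0ℤ + g k ∎
  where
  ring : ∀ K x → 0ℤ + ((1ℤ + K) * (0ℤ - x) + (1ℤ + (1ℤ + K)) * x - (0ℤ + (1ℤ + (1ℤ + K)) * 0ℤ))
    ≡ (1ℤ + K) * 0ℤ + 0ℤ + x
  ring = solve-∀
gap-weighted k g g≡0 (suc i) i<k = begin
  gap (weighted k g) (suc k) (suc (suc i))
    ≡⟨ gap-suc (weighted k g) (suc k) (suc i) ⟩
  gap (weighted k g) (suc k) (suc i) + (weighted k g (k ∸ i) - weighted k g (suc i))
    ≡⟨ cong (_+ (weighted k g (k ∸ i) - weighted k g (suc i)))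
         (gap-weighted k g g≡0 i (ℕ.<⇒≤ i<k)) ⟩
  + (suc k ∸ i) * gap g k i + + i * gap g k (suc i) + g (k ∸ i)
    + (weighted k g (k ∸ i) - weighted k g (suc i))
    ≡⟨ step (k ∸ suc i) i {k} {s = gap g k i}
         (sym (ℕ.m+[n∸m]≡n i<k)) (∸-step i<k)
         (trans (∸-step (ℕ.m<n⇒m<1+n i<k)) (cong suc (∸-step i<k)))
         (gap-suc g k i) (gap-suc g k (suc i)) ⟩
  + (k ∸ i) * gap g k (suc i) + + suc i * gap g k (suc (suc i)) + g (k ∸ suc i) ∎
  where
  ring : ∀ M I s a b c e →
    (1ℤ + (1ℤ + M)) * s + I * (s + (a - e)) + a
      + ((1ℤ + M) * (a - b) + (1ℤ + (1ℤ + ((1ℤ + I) + M))) * b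
        - ((1ℤ + I) * (c - e) + (1ℤ + (1ℤ + ((1ℤ + I) + M))) * e))
    ≡ (1ℤ + M) * (s + (a - e)) + (1ℤ + I) * (s + (a - e) + (b - c)) + b
  ring = solve-∀
  -- Naming `m = k - (i+1)` removes every truncated subtraction, which leaves a polynomial identity
  -- for `ring`.
  step : ∀ m i {k u v s s′ s″} → k ≡ suc i ℕ.+ m → u ≡ suc m → v ≡ suc (suc m) →
    s′ ≡ s + (g u - g i) → s″ ≡ s′ + (g m - g (suc i)) →
    + v * s + + i * s′ + g u + (weighted k g u - weighted k g (suc i))
    ≡ + u * s′ + + suc i * s″ + g m
  step m i {s = s} refl refl refl refl refl =
    ring (+ m) (+ i) s (g (suc m)) (g m) (g (suc i)) (g i)

-- Both sums of `Δ g` telescope: the bottom one to `g i`, the top one to `g (suc k) - g (k ∸ i)`,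
-- whose first term is zero.
gap-minus-Δ : ∀ k h g → g (suc k) ≡ 0ℤ → ∀ i → i ℕ.≤ k →
  gap (λ n → h n - Δ g n) (suc k) (suc i) ≡ gap h (suc k) (suc i) + (g (k ∸ i) + g i)
gap-minus-Δ k h g g≡0 zero _ = begin
  gap D (suc k) 1
    ≡⟨ gap-suc D (suc k) 0 ⟩
  0ℤ + (h (suc k) - (g (suc k) - g k) - (h 0 - (g 0 - 0ℤ)))
    ≡⟨ cong (λ x → 0ℤ + (h (suc k) - (x - g k) - (h 0 - (g 0 - 0ℤ)))) g≡0 ⟩
  0ℤ + (h (suc k) - (0ℤ - g k) - (h 0 - (g 0 - 0ℤ)))
    ≡⟨ ring (h (suc k)) (g k) (h 0) (g 0) ⟩
  0ℤ + (h (suc k) - h 0) + (g k + g 0)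
    ≡⟨ cong (_+ (g k + g 0)) (gap-suc h (suc k) 0) ⟨
  gap h (suc k) 1 + (g k + g 0) ∎
  where
  D = λ n → h n - Δ g n
  ring : ∀ a b c e → 0ℤ + (a - (0ℤ - b) - (c - (e - 0ℤ))) ≡ 0ℤ + (a - c) + (b + e)
  ring = solve-∀
gap-minus-Δ k h g g≡0 (suc i) i<k = begin
  gap D (suc k) (suc (suc i))
    ≡⟨ gap-suc D (suc k) (suc i) ⟩
  gap D (suc k) (suc i) + (D (k ∸ i) - D (suc i))
    ≡⟨ cong (_+ (D (k ∸ i) - D (suc i))) (gap-minus-Δ k h g g≡0 i (ℕ.<⇒≤ i<k)) ⟩
  gap h (suc k) (suc i) + (g (k ∸ i) + g i) + (D (k ∸ i) - D (suc i))
    ≡⟨ step (k ∸ suc i) (gap h (suc k) (suc i)) (∸-step i<k) ⟩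
  gap h (suc k) (suc i) + (h (k ∸ i) - h (suc i)) + (g (k ∸ suc i) + g (suc i))
    ≡⟨ cong (_+ (g (k ∸ suc i) + g (suc i))) (gap-suc h (suc k) (suc i)) ⟨
  gap h (suc k) (suc (suc i)) + (g (k ∸ suc i) + g (suc i)) ∎
  where
  D = λ n → h n - Δ g n
  ring : ∀ s a b x y e f →
    s + (a + b) + (x - (a - e) - (y - (f - b))) ≡ s + (x - y) + (e + f)
  ring = solve-∀
  step : ∀ m s {u} → u ≡ suc m →
    s + (g u + g i) + (D u - D (suc i)) ≡ s + (h u - h (suc i)) + (g m + g (suc i))
  step m s refl = ring s (g (suc m)) (g i) (h (suc m)) (h (suc i)) (g m) (g (suc i))

module _ {k g} (g-vec : HVector k g) (0≤g : ∀ n → 0ℤ ≤ g n) where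

  private
    g-top : g (suc k) ≡ 0ℤ
    g-top = vanishes g-vec (suc k) ℕ.≤-refl

  HVector-weighted : HVector (suc k) (weighted k g)
  HVector-weighted .vanishes (suc i) (s≤s k<i) = begin
    + suc i * (g (suc i) - g i) + + (2 ℕ.+ k) * g i
      ≡⟨ cong₂ (λ x y → + suc i * (x - y) + + (2 ℕ.+ k) * y)
           (vanishes g-vec (suc i) (ℕ.m<n⇒m<1+n k<i)) (vanishes g-vec i k<i) ⟩
    + suc i * 0ℤ + + (2 ℕ.+ k) * 0ℤ
      ≡⟨ cong₂ _+_ (ℤ.*-zeroʳ (+ suc i)) (ℤ.*-zeroʳ (+ (2 ℕ.+ k))) ⟩
    0ℤ ∎
  HVector-weighted .gaps zero    _         = ℤ.≤-refl
  HVector-weighted .gaps (suc i) (s≤s i≤k) = subst (0ℤ ≤_)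
    (sym (gap-weighted k g g-top i i≤k))
    (0≤+ (0≤+ (0≤* (suc k ∸ i) (gaps g-vec i i≤k))
              (0≤* i (gaps-extended g-vec (suc i) (s≤s i≤k))))
         (0≤g (k ∸ i)))

  weighted-top : weighted k g (suc k) ≡ g k
  weighted-top = trans
    (cong (λ x → + suc k * (x - g k) + + (2 ℕ.+ k) * g k) g-top) (ring (+ k) (g k))
    where
    ring : ∀ K x → (1ℤ + K) * (0ℤ - x) + (1ℤ + (1ℤ + K)) * x ≡ x
    ring = solve-∀

  HVector-minus-Δ : ∀ {h} → HVector (suc k) h → HVector (suc k) (λ n → h n - Δ g n)
  HVector-minus-Δ h-vec .vanishes (suc i) (s≤s k<i) = cong₂ _-_
    (vanishes h-vec (suc i) (s≤s k<i))
    (cong₂ _-_ (vanishes g-vec (suc i) (ℕ.m<n⇒m<1+n k<i)) (vanishes g-vec i k<i))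
  HVector-minus-Δ h-vec .gaps zero    _         = ℤ.≤-refl
  HVector-minus-Δ {h} h-vec .gaps (suc i) (s≤s i≤k) = subst (0ℤ ≤_)
    (sym (gap-minus-Δ k h g g-top i i≤k))
    (0≤+ (gaps h-vec (suc i) (s≤s i≤k)) (0≤+ (0≤g (k ∸ i)) (0≤g i)))

  -- Since `g (suc k)` is zero, the subtracted term is `- g k`, so adding an edge cannot lower the
  -- leading coefficient.
  minus-Δ-top : ∀ {x} → 0ℤ < x → 0ℤ < x - Δ g (suc k)
  minus-Δ-top {x} 0<x = subst (λ y → 0ℤ < x - (y - g k)) (sym g-top)
    (subst (0ℤ <_) (ring x (g k)) (ℤ.+-mono-<-≤ 0<x (0≤g k)))
    where
    ring : ∀ x y → x + y ≡ x - (0ℤ - y)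
    ring = solve-∀

-- Induction on the number of vertices

module _ {k} (IH : (G : LoopGraph k) → HVector k (hPoly G)) where

  hCone : List (Fin k) → LoopGraph k → PowerSeries
  hCone N G = Δ^ (2 ℕ.+ k) (coneχ N G)

  hCone-[] : ∀ G → hCone [] G ≗ weighted k (hPoly G)
  hCone-[] G n = trans (Δ^-cong (2 ℕ.+ k) (coneχ-[] G) n) (Δ^-θ (suc k) (χ G) n)

  hCone-∷ : ∀ v N G → hCone (v ∷ N) G ≗ λ n → hCone N G n - Δ (hPoly (attach v N G)) n
  hCone-∷ v N G n = trans
    (Δ^-cong (2 ℕ.+ k) (coneχ-∷ v N G) n)
    (Δ^-minus (2 ℕ.+ k) (coneχ N G) (χ (attach v N G)) n)

  -- The new vertex starts isolated and its edges are added one by one. Every contraction has only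
  -- `k` vertices, so `IH` covers it.
  HVector-hCone : ∀ N G → HVector (suc k) (hCone N G)
  HVector-hCone []      G = HVector-cong (hCone-[] G) (HVector-weighted (IH G) (hPoly-nonneg G))
  HVector-hCone (v ∷ N) G = HVector-cong (hCone-∷ v N G)
    (HVector-minus-Δ (IH (attach v N G)) (hPoly-nonneg (attach v N G)) (HVector-hCone N G))

  hCone-top : ∀ N G → 0ℤ < hPoly G k → 0ℤ < hCone N G (suc k)
  hCone-top []      G 0<h = subst (0ℤ <_)
    (sym (trans (hCone-[] G (suc k)) (weighted-top (IH G) (hPoly-nonneg G)))) 0<h
  hCone-top (v ∷ N) G 0<h = subst (0ℤ <_) (sym (hCone-∷ v N G (suc k)))
    (minus-Δ-top (IH (attach v N G)) (hPoly-nonneg (attach v N G)) (hCone-top N G 0<h))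

HVector-hPoly : ∀ {k} (G : LoopGraph k) → HVector k (hPoly G)
-- Without vertices `χ` is constantly 1 and its `hPoly` is the constant polynomial 1.
HVector-hPoly {zero}  G .vanishes (suc zero)    _ = refl
HVector-hPoly {zero}  G .vanishes (suc (suc i)) _ = refl
HVector-hPoly {zero}  G .gaps zero _ = ℤ.≤-refl
HVector-hPoly {suc k} G = by-loop (adj? G zero zero)
  where
  by-loop : Dec (Adj G zero zero) → HVector (suc k) (hPoly G)
  by-loop (yes loop)  = HVector-zero (hPoly-loop G zero loop)
  by-loop (no noloop) = HVector-cong (Δ^-cong (2 ℕ.+ k) (χ-cone G noloop))
    (HVector-hCone HVector-hPoly (neighbours₀ G) (induced suc G))

-- Positivity is carried along the graphs with the first vertex removed, which stay loopless. The
-- contractions contribute only nonnegative terms, loops or not.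
hPoly-top : ∀ {k} (G : LoopGraph k) → Loopless G → 0ℤ < hPoly G k
hPoly-top {zero}  G loopless = +<+ (s≤s z≤n)
hPoly-top {suc k} G loopless = subst (0ℤ <_)
  (sym (Δ^-cong (2 ℕ.+ k) (χ-cone G (loopless zero)) (suc k)))
  (hCone-top HVector-hPoly (neighbours₀ G) (induced suc G)
    (hPoly-top (induced suc G) (loopless ∘ suc)))

-- Transfer to the series of the theorem

h-series-hPoly : ∀ {d} (G : SimpleGraph d) → h-series G ≗ hPoly (fromSimple G)
h-series-hPoly {d} G n = trans
  (1-z^-⊛ (suc d) (chromaticSeries G) n) (Δ^-cong (suc d) (chromatic-χ G) n)

-- Places the range of the theorem within the range `i ≤ d` of the invariant.
⌊1+n/2⌋≤n : ∀ n → ⌊ suc n /2⌋ ℕ.≤ n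
⌊1+n/2⌋≤n zero    = z≤n
⌊1+n/2⌋≤n (suc n) = s≤s (ℕ.⌊n/2⌋≤n n)

theorem1p4 : (d : ℕ) (G : SimpleGraph d) →
    let h = h-series G in
    IsPolynomialOfDegree h d
    × (∀ k → 0ℤ ≤ h k)
    × (∀ i → 1 ℕ.≤ i → i ℕ.≤ ⌊ suc d /2⌋ →
    0ℤ ≤ (∑[ j < i ] h (d ∸ toℕ j)) - (∑[ j < i ] h (toℕ j)))
theorem1p4 d G =
  ( (λ h≡0 → ℤ.<-irrefl (trans (sym h≡0) (h-series-hPoly G d)) (hPoly-top (fromSimple G) loopless))
  , vanishes H )
  , (λ k → subst (0ℤ ≤_) (sym (h-series-hPoly G k)) (hPoly-nonneg (fromSimple G) k))
  , (λ i _ i≤ → gaps H i (ℕ.≤-trans i≤ (⌊1+n/2⌋≤n d)))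
  where
  loopless : Loopless (fromSimple G)
  loopless i = SimpleGraph.irrefl G refl
  H : HVector d (h-series G)
  H = HVector-cong (h-series-hPoly G) (HVector-hPoly (fromSimple G))
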